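{- Let $p$ be an odd prime and let $N_{p-2}$ be the number of permutations of $p-2$ letters with an even number of ascents. Then $$\sum_{\substack{k=1\\ k\text{ odd}}}^{\frac{p-1}{2}}\frac1k\equiv\frac12\bigl(1-2N_{p-2}\bigr)\pmod p.$$
   Context: Congruences are taken in $\mathbb{Z}_p$. For a permutation $(i_1,\dots,i_n)$ of $\{1,\dots,n\}$ (mapping $j$ to $i_j$), an ascent is an index $k$ with $i_{k+1}>i_k$. -}

module Defs where

open import Data.Nat as ℕ using (ℕ; zero; suc; _<ᵇ_)
open import Data.Nat.Divisibility using (_∣_; _∣?_)
open import Data.Integer as ℤ using (ℤ; +_)
open import Data.Rational as ℚ using (ℚ; ↥_; ↧ₙ_)
open import Data.Fin using (Fin)
open import Data.Vec using (Vec; []; _∷_; toList)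
open import Data.List as List using (List; []; _∷_; concatMap; map; allFin; length; filter)
open import Data.List.Relation.Unary.Unique.Propositional using (Unique)
open import Data.List.Relation.Unary.Unique.DecPropositional using (unique?)
open import Data.Fin.Properties using (_≟_)
open import Data.Bool using (if_then_else_; true; false)
open import Data.Product using (_×_)
open import Relation.Nullary using (¬_; does)
open import Relation.Nullary.Decidable using (_×-dec_)

allVecs : (m n : ℕ) → List (Vec (Fin m) n)
allVecs m zero = [] ∷ []
allVecs m (suc n) = concatMap (λ x → map (x ∷_) (allVecs m n)) (allFin m)

ascents : ∀ {m} → List (Fin m) → ℕ
ascents [] = 0
ascents (x ∷ []) = 0
ascents (x ∷ y ∷ xs) =
  (if Data.Fin.toℕ x <ᵇ Data.Fin.toℕ y then 1 else 0) ℕ.+ ascents (y ∷ xs)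

-- A permutation of n letters (letters 0..n-1, order-isomorphic to 1..n) in
-- one-line notation: a length-n word over Fin n with pairwise distinct entries.
IsPermutation : ∀ n → Vec (Fin n) n → Set
IsPermutation n v = Unique (toList v)

EvenAscents : ∀ n → Vec (Fin n) n → Set
EvenAscents n v = 2 ∣ ascents (toList v)

N : ℕ → ℕ
N n = length (filter (λ v → unique? _≟_ (toList v) ×-dec (2 ∣? ascents (toList v)))
                     (allVecs n n))

oddHarmonic : ℕ → ℚ
oddHarmonic zero = ℚ.0ℚ
oddHarmonic (suc k) =
  oddHarmonic k ℚ.+ (if does (2 ∣? suc k) then ℚ.0ℚ else (+ 1 ℚ./ suc k))

-- Congruence modulo p in ℤ_p for rationals: both sides are p-integral
-- (p does not divide the reduced denominators) and p divides the numerator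
-- of the difference.
_≡_[modℚ_] : ℚ → ℚ → ℕ → Set
a ≡ b [modℚ p ] = ¬ (p ∣ ↧ₙ a) × ¬ (p ∣ ↧ₙ b) × (p ∣ ℤ.∣ ↥ (a ℚ.- b) ∣)

{-# OPTIONS --safe #-}
module Submission where

-- Counting permutations with sign (-1)^ascents gives 2 N n = n! + A, where
-- A is the Eulerian polynomial at -1.  Let n = p - 2 and h = (p - 1)/2.
-- Refining A by the first letter, its recursion is solved modulo p by alternating
-- power sums, so that 2 A ≡ Σ_{0<j<p} (-1)^(j-1)/j =: S, while n! ≡ 1 by Wilson.
-- Let H be the harmonic sum up to h, and O, E its parts with odd and even index.
-- The reflection j ↦ p - j gives S ≡ 2 (O - E) and Σ_{0<j<p} 1/j ≡ 0; subtracting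
-- twice the even-index terms from the latter also gives S ≡ - H = - (O + E).
-- Together S ≡ - 4 O, hence 2 (1 - 2 N n) ≡ - 2 A ≡ 4 O.
-- Fermat and Wilson both follow from Newton's formula f(p) = Σ_k (p C k) Δ^k f(0),
-- which modulo p collapses to f(0) + Δ^p f(0).

open import Defs
open import Algebra.Bundles using (CommutativeRing)
import Algebra.Properties.Semiring.Sum
open import Data.Bool.Base using (Bool; true; false; _∧_; if_then_else_)
open import Data.Empty using (⊥-elim)
open import Data.Fin.Base using (Fin; zero; suc; toℕ; punchIn)
open import Data.Fin.Properties using (_≟_; punchIn-injective; punchInᵢ≢i; toℕ<n)
open import Data.Integer as ℤ using (ℤ; +_; 0ℤ; 1ℤ; -1ℤ; _+_; _-_; _*_; -_; _^_; ∣_∣)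
import Data.Integer.Properties as ℤ
open import Data.Integer.Divisibility.Signed using (divides; ∣ᵤ⇒∣; ∣⇒∣ᵤ)
  renaming (_∣_ to _∣ℤ_; ∣m∣n⇒∣m+n to ∣ℤ-+; ∣m⇒∣-m to ∣ℤ-neg; ∣n⇒∣m*n to ∣ℤ-*)
open import Data.Integer.Tactic.RingSolver using (solve-∀)
open import Data.List.Base as List using (List; []; _∷_; _++_; concatMap; allFin; length; filter)
open import Data.List.Relation.Unary.All using (all?)
open import Data.List.Relation.Unary.Unique.DecPropositional using (unique?)
import Data.List.Relation.Unary.Unique.Propositional.Properties as Unique
open import Data.Nat as ℕ using (ℕ; zero; suc; _∸_; _/_; _!; _<ᵇ_; z≤n; s≤s; NonZero)
import Data.Nat.Properties as ℕ
open import Data.Nat.Combinatorics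
  using (_C_; nCn≡1; nCk≡nC[n∸k]; nCk+nC[k+1]≡[n+1]C[k+1]; k>n⇒nCk≡0; nCk≡n!/k![n-k]!; k![n∸k]!∣n!)
import Data.Nat.Coprimality as Coprime
open import Data.Nat.DivMod using (m/n*n≡m; m*n/n≡m)
open import Data.Nat.Divisibility as ℕ∣ using (_∣_; _∣?_; m∣m*n; ∣⇒≤; ∣-refl; ∣m+n∣m⇒∣n; ∣m∣n⇒∣m+n; ∣n⇒∣m*n)
open import Data.Nat.Primality
  using (Prime; euclidsLemma; ¬prime[1]; prime⇒irreducible; prime⇒nonTrivial)
open import Data.Product.Base using (_,_; ∃-syntax)
open import Data.Rational as ℚ using (ℚ; mkℚ; toℚᵘ; ↥_; ↧_; ↧ₙ_)
import Data.Rational.Properties as ℚ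
import Data.Rational.Unnormalised.Base as ℚᵘ
open import Data.Sum.Base using (_⊎_; inj₁; inj₂; [_,_]′)
open import Data.Vec.Base as Vec using (Vec; []; _∷_; toList)
open import Data.Vec.Properties using (toList-map)
open import Function.Base using (_∘_)
open import Function.Bundles using (mk⇔)
open import Level using (0ℓ)
open import Relation.Binary.PropositionalEquality
  using (_≡_; _≢_; _≗_; refl; sym; trans; cong; cong₂; subst; module ≡-Reasoning)
import Relation.Binary.Reasoning.Setoid as SetoidReasoning
open import Relation.Nullary using (¬_; contradiction)
open import Relation.Nullary.Decidable
  using (does; dec-true; dec-false; does-⇔; ¬?; _×-dec_)
open import Relation.Unary using (Decidable)

open Algebra.Properties.Semiring.Sum ℤ.+-*-semiring using (sum; sum-cong-≗; sum-remove)

-- Sums over lists and over words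

sumOver : {A : Set} → (A → ℤ) → List A → ℤ
sumOver f []       = 0ℤ
sumOver f (x ∷ xs) = f x + sumOver f xs

module _ {A : Set} where

  sumOver-cong : {f g : A → ℤ} → f ≗ g → sumOver f ≗ sumOver g
  sumOver-cong f≗g []       = refl
  sumOver-cong f≗g (x ∷ xs) = cong₂ _+_ (f≗g x) (sumOver-cong f≗g xs)

  sumOver-*ˡ : ∀ c (f : A → ℤ) xs → sumOver (λ x → c * f x) xs ≡ c * sumOver f xs
  sumOver-*ˡ c f []       = sym (ℤ.*-zeroʳ c)
  sumOver-*ˡ c f (x ∷ xs) =
    trans (cong (_+_ (c * f x)) (sumOver-*ˡ c f xs)) (sym (ℤ.*-distribˡ-+ c (f x) (sumOver f xs)))

  sumOver-+ : ∀ (f g : A → ℤ) xs → sumOver (λ x → f x + g x) xs ≡ sumOver f xs + sumOver g xs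
  sumOver-+ f g []       = refl
  sumOver-+ f g (x ∷ xs) = trans (cong (_+_ (f x + g x)) (sumOver-+ f g xs)) (lemma (f x) (g x) _ _) where
    lemma : ∀ a b c d → a + b + (c + d) ≡ a + c + (b + d)
    lemma = solve-∀

  sumOver-++ : ∀ (f : A → ℤ) xs ys → sumOver f (xs ++ ys) ≡ sumOver f xs + sumOver f ys
  sumOver-++ f []       ys = sym (ℤ.+-identityˡ _)
  sumOver-++ f (x ∷ xs) ys = trans (cong (_+_ (f x)) (sumOver-++ f xs ys)) (sym (ℤ.+-assoc (f x) _ _))

  sumOver-map : ∀ {B : Set} (f : B → ℤ) (g : A → B) xs → sumOver f (List.map g xs) ≡ sumOver (f ∘ g) xs
  sumOver-map f g []       = refl
  sumOver-map f g (x ∷ xs) = cong (_+_ (f (g x))) (sumOver-map f g xs)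

  sumOver-tabulate : ∀ {n} (f : A → ℤ) (g : Fin n → A) → sumOver f (List.tabulate g) ≡ sum (f ∘ g)
  sumOver-tabulate {zero}  f g = refl
  sumOver-tabulate {suc n} f g = cong (_+_ (f (g zero))) (sumOver-tabulate f (g ∘ suc))

sumOver-concatMap : ∀ {A B : Set} (f : B → ℤ) (g : A → List B) xs →
                    sumOver f (concatMap g xs) ≡ sumOver (sumOver f ∘ g) xs
sumOver-concatMap f g []       = refl
sumOver-concatMap f g (x ∷ xs) =
  trans (sumOver-++ f (g x) _) (cong (_+_ (sumOver f (g x))) (sumOver-concatMap f g xs))

sumOver-allVecs : ∀ m n (f : Vec (Fin m) (suc n) → ℤ) →
  sumOver f (allVecs m (suc n)) ≡ sum (λ x → sumOver (λ w → f (x ∷ w)) (allVecs m n))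
sumOver-allVecs m n f = begin
  sumOver f (allVecs m (suc n))
    ≡⟨ sumOver-concatMap f _ (allFin m) ⟩
  sumOver (λ x → sumOver f (List.map (x ∷_) (allVecs m n))) (allFin m)
    ≡⟨ sumOver-cong (λ x → sumOver-map f (x ∷_) (allVecs m n)) (allFin m) ⟩
  sumOver (λ x → sumOver (λ w → f (x ∷ w)) (allVecs m n)) (allFin m)
    ≡⟨ sumOver-tabulate (λ x → sumOver (λ w → f (x ∷ w)) (allVecs m n)) (λ i → i) ⟩
  sum (λ x → sumOver (λ w → f (x ∷ w)) (allVecs m n)) ∎
  where open ≡-Reasoning

χ : Bool → ℤ
χ b = if b then 1ℤ else 0ℤ

χ-∧ : ∀ a b → χ (a ∧ b) ≡ χ a * χ b
χ-∧ true  b = sym (ℤ.*-identityˡ (χ b))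
χ-∧ false b = refl

avoids : ∀ {m} → Fin m → List (Fin m) → Bool
avoids x l = does (all? (λ y → ¬? (x ≟ y)) l)

-- The words avoiding a letter x are the images under punchIn x of the words
-- over an alphabet with one letter less.
sumOver-avoids : ∀ {m} n (x : Fin (suc m)) (f : Vec (Fin (suc m)) n → ℤ) →
  sumOver (λ w → χ (avoids x (toList w)) * f w) (allVecs (suc m) n) ≡
  sumOver (λ w → f (Vec.map (punchIn x) w)) (allVecs m n)
sumOver-avoids zero    x f = cong (_+ 0ℤ) (ℤ.*-identityˡ (f []))
sumOver-avoids {m} (suc n) x f = begin
  sumOver (λ w → χ (avoids x (toList w)) * f w) (allVecs (suc m) (suc n))
    ≡⟨ sumOver-allVecs (suc m) n _ ⟩
  sum (λ y → sumOver (λ w → χ (differs y ∧ avoids x (toList w)) * f (y ∷ w)) (allVecs (suc m) n))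
    ≡⟨ sum-cong-≗ (λ y → trans (sumOver-cong (split y) (allVecs (suc m) n))
                               (sumOver-*ˡ (χ (differs y)) _ (allVecs (suc m) n))) ⟩
  sum (λ y → χ (differs y) * sumOver (λ w → χ (avoids x (toList w)) * f (y ∷ w)) (allVecs (suc m) n))
    ≡⟨ sum-cong-≗ (λ y → cong (χ (differs y) *_) (sumOver-avoids n x (λ w → f (y ∷ w)))) ⟩
  sum term
    ≡⟨ sum-remove {i = x} term ⟩
  term x + sum (λ z → term (punchIn x z))
    ≡⟨ cong₂ _+_ at-x (sum-cong-≗ off-x) ⟩
  0ℤ + sum (λ z → rest (punchIn x z))
    ≡⟨ ℤ.+-identityˡ _ ⟩
  sum (λ z → rest (punchIn x z))
    ≡⟨ sumOver-allVecs m n _ ⟨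
  sumOver (λ w → f (Vec.map (punchIn x) w)) (allVecs m (suc n)) ∎
  where
  open ≡-Reasoning

  differs : Fin (suc m) → Bool
  differs y = does (¬? (x ≟ y))

  rest term : Fin (suc m) → ℤ
  rest y = sumOver (λ w → f (y ∷ Vec.map (punchIn x) w)) (allVecs m n)
  term y = χ (differs y) * rest y

  split : ∀ y w → χ (differs y ∧ avoids x (toList w)) * f (y ∷ w) ≡
                  χ (differs y) * (χ (avoids x (toList w)) * f (y ∷ w))
  split y w = trans (cong (_* f (y ∷ w)) (χ-∧ (differs y) _)) (ℤ.*-assoc (χ (differs y)) _ _)

  at-x : term x ≡ 0ℤ
  at-x = cong (λ b → χ b * rest x) (dec-false (¬? (x ≟ x)) (λ x≢x → x≢x refl))

  off-x : ∀ z → term (punchIn x z) ≡ rest (punchIn x z)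
  off-x z = trans (cong (λ b → χ b * rest (punchIn x z))
                        (dec-true (¬? (x ≟ punchIn x z)) (punchInᵢ≢i x z ∘ sym)))
                  (ℤ.*-identityˡ _)

-- Ascents and distinctness under relabelling by `punchIn`

⟦_<_⟧ : ℕ → ℕ → ℕ
⟦ i < j ⟧ = if i <ᵇ j then 1 else 0

-- `punchIn x` pushes exactly the letters from `x` upwards past `x`, so after closing the gap an
-- ascent out of `x` becomes the non-strict `x ≤ j`, written `x < suc j`.
toℕ-punchIn-<ᵇ : ∀ {n} (x : Fin (suc n)) j → (toℕ x <ᵇ toℕ (punchIn x j)) ≡ (toℕ x <ᵇ suc (toℕ j))
toℕ-punchIn-<ᵇ zero    j       = refl
toℕ-punchIn-<ᵇ (suc x) zero    = refl
toℕ-punchIn-<ᵇ (suc x) (suc j) = toℕ-punchIn-<ᵇ x j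

punchIn-<ᵇ : ∀ {n} (x : Fin (suc n)) i j → (toℕ (punchIn x i) <ᵇ toℕ (punchIn x j)) ≡ (toℕ i <ᵇ toℕ j)
punchIn-<ᵇ zero    i       j       = refl
punchIn-<ᵇ (suc x) zero    zero    = refl
punchIn-<ᵇ (suc x) zero    (suc j) = refl
punchIn-<ᵇ (suc x) (suc i) zero    = refl
punchIn-<ᵇ (suc x) (suc i) (suc j) = punchIn-<ᵇ x i j

ascents-punchIn : ∀ {n} (x : Fin (suc n)) l → ascents (List.map (punchIn x) l) ≡ ascents l
ascents-punchIn x []          = refl
ascents-punchIn x (i ∷ [])    = refl
ascents-punchIn x (i ∷ j ∷ l) =
  cong₂ (λ b a → (if b then 1 else 0) ℕ.+ a) (punchIn-<ᵇ x i j) (ascents-punchIn x (j ∷ l))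

isUnique : ∀ {m} → List (Fin m) → Bool
isUnique l = does (unique? _≟_ l)

isUnique-punchIn : ∀ {n} (x : Fin (suc n)) l → isUnique (List.map (punchIn x) l) ≡ isUnique l
isUnique-punchIn x l =
  does-⇔ (mk⇔ Unique.map⁻ (Unique.map⁺ (punchIn-injective x _ _)))
         (unique? _≟_ (List.map (punchIn x) l)) (unique? _≟_ l)

-- Eulerian polynomials

weight : ∀ {m n} → ℤ → Vec (Fin m) n → ℤ
weight t v = χ (isUnique (toList v)) * t ^ ascents (toList v)

eulerian : ℤ → ℕ → ℤ
eulerian t n = sumOver (weight t) (allVecs n n)

-- The part of eulerian t (suc n) coming from the permutations with first
-- letter i; deleting that letter and closing the gap gives the recursion.
eulerianFrom : ℤ → ℕ → ℕ → ℤ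
eulerianFrom t zero    i = 1ℤ
eulerianFrom t (suc n) i = sum {suc n} (λ j → t ^ ⟦ i < suc (toℕ j) ⟧ * eulerianFrom t n (toℕ j))

sumOver-weight-∷ : ∀ t n (x : Fin (suc n)) →
  sumOver (λ w → weight t (x ∷ w)) (allVecs (suc n) n) ≡ eulerianFrom t n (toℕ x)
sumOver-weight-∷ t zero    x = refl
sumOver-weight-∷ t (suc n) x = begin
  sumOver (λ w → weight t (x ∷ w)) (allVecs (suc (suc n)) (suc n))
    ≡⟨ sumOver-cong split (allVecs (suc (suc n)) (suc n)) ⟩
  sumOver (λ w → χ (avoids x (toList w)) * tailWeight w) (allVecs (suc (suc n)) (suc n))
    ≡⟨ sumOver-avoids (suc n) x tailWeight ⟩
  sumOver (λ w → tailWeight (Vec.map (punchIn x) w)) (allVecs (suc n) (suc n))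
    ≡⟨ sumOver-allVecs (suc n) n _ ⟩
  sum (λ j → sumOver (λ w → tailWeight (Vec.map (punchIn x) (j ∷ w))) (allVecs (suc n) n))
    ≡⟨ sum-cong-≗ {suc n} (λ j → trans (sumOver-cong (step j) (allVecs (suc n) n))
                                 (sumOver-*ˡ (t ^ ⟦ toℕ x < suc (toℕ j) ⟧) _ (allVecs (suc n) n))) ⟩
  sum (λ j → t ^ ⟦ toℕ x < suc (toℕ j) ⟧ * sumOver (λ w → weight t (j ∷ w)) (allVecs (suc n) n))
    ≡⟨ sum-cong-≗ {suc n} (λ j → cong (t ^ ⟦ toℕ x < suc (toℕ j) ⟧ *_) (sumOver-weight-∷ t n j)) ⟩
  eulerianFrom t (suc n) (toℕ x) ∎
  where
  open ≡-Reasoning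

  -- Distinctness is asked of `w` alone, while the ascents still count `x` in front: the condition
  -- that `w` avoids `x` is the separate factor handled by `sumOver-avoids`.
  tailWeight : Vec (Fin (suc (suc n))) (suc n) → ℤ
  tailWeight w = χ (isUnique (toList w)) * t ^ ascents (toList (x ∷ w))

  split : ∀ w → weight t (x ∷ w) ≡ χ (avoids x (toList w)) * tailWeight w
  split w = trans (cong (_* t ^ ascents (toList (x ∷ w))) (χ-∧ (avoids x (toList w)) _))
                  (ℤ.*-assoc (χ (avoids x (toList w))) _ _)

  step : ∀ j w → tailWeight (Vec.map (punchIn x) (j ∷ w)) ≡
                 t ^ ⟦ toℕ x < suc (toℕ j) ⟧ * weight t (j ∷ w)
  step j w rewrite toList-map (punchIn x) w
                 | isUnique-punchIn x (j ∷ toList w)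
                 | ascents-punchIn x (j ∷ toList w)
                 | toℕ-punchIn-<ᵇ x j
                 | ℤ.^-distribˡ-+-* t ⟦ toℕ x < suc (toℕ j) ⟧ (ascents (j ∷ toList w))
    = lemma (χ (isUnique (j ∷ toList w))) (t ^ ⟦ toℕ x < suc (toℕ j) ⟧) (t ^ ascents (j ∷ toList w))
    where
    lemma : ∀ a b c → a * (b * c) ≡ b * (a * c)
    lemma = solve-∀

eulerian-suc : ∀ t n → eulerian t (suc n) ≡ sum {suc n} (eulerianFrom t n ∘ toℕ)
eulerian-suc t n = trans (sumOver-allVecs (suc n) n (weight t)) (sum-cong-≗ {suc n} (sumOver-weight-∷ t n))

-- Extracting the permutations with an even number of ascents

length-filter : ∀ {A : Set} {P : A → Set} (P? : Decidable P) xs →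
                + length (filter P? xs) ≡ sumOver (χ ∘ does ∘ P?) xs
length-filter P? []       = refl
length-filter P? (x ∷ xs) with does (P? x)
... | true  = cong (_+_ 1ℤ) (length-filter P? xs)
... | false = trans (length-filter P? xs) (sym (ℤ.+-identityˡ (sumOver (χ ∘ does ∘ P?) xs)))

sum-const : ∀ n c → sum {n} (λ _ → c) ≡ + n * c
sum-const zero    c = refl
sum-const (suc n) c = trans (cong (_+_ c) (sum-const n c)) (lemma c (+ n)) where
  lemma : ∀ c m → c + m * c ≡ (1ℤ + m) * c
  lemma = solve-∀

eulerianFrom-1 : ∀ n i → eulerianFrom 1ℤ n i ≡ + (n !)
eulerianFrom-1 zero    i = refl
eulerianFrom-1 (suc n) i = begin
  sum {suc n} (λ j → 1ℤ ^ ⟦ i < suc (toℕ j) ⟧ * eulerianFrom 1ℤ n (toℕ j))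
    ≡⟨ sum-cong-≗ {suc n} (λ j → cong₂ _*_ (ℤ.^-zeroˡ ⟦ i < suc (toℕ j) ⟧) (eulerianFrom-1 n (toℕ j))) ⟩
  sum {suc n} (λ _ → 1ℤ * + (n !))
    ≡⟨ sum-const (suc n) (1ℤ * + (n !)) ⟩
  + suc n * (1ℤ * + (n !))
    ≡⟨ cong (_*_ (+ suc n)) (ℤ.*-identityˡ (+ (n !))) ⟩
  + suc n * + (n !)
    ≡⟨ ℤ.pos-* (suc n) (n !) ⟨
  + (suc n !) ∎
  where open ≡-Reasoning

eulerian-1 : ∀ n → eulerian 1ℤ n ≡ + (n !)
eulerian-1 zero    = refl
eulerian-1 (suc n) = begin
  eulerian 1ℤ (suc n)                    ≡⟨ eulerian-suc 1ℤ n ⟩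
  sum {suc n} (eulerianFrom 1ℤ n ∘ toℕ)  ≡⟨ sum-cong-≗ {suc n} (λ j → eulerianFrom-1 n (toℕ j)) ⟩
  sum {suc n} (λ _ → + (n !))            ≡⟨ sum-const (suc n) (+ (n !)) ⟩
  + suc n * + (n !)                      ≡⟨ ℤ.pos-* (suc n) (n !) ⟨
  + (suc n !) ∎
  where open ≡-Reasoning

-- The parity filter `(1 + (-1)^a) / 2`, doubled to stay in the integers; `1ℤ ^ a` is kept because
-- it is the weight factor at `t = 1`.
even-indicator : ∀ a → + 2 * χ (does (2 ∣? a)) ≡ 1ℤ ^ a + -1ℤ ^ a
even-indicator zero          = refl
even-indicator (suc zero)    = refl
even-indicator (suc (suc a)) = begin
  + 2 * χ (does (2 ∣? suc (suc a)))
    ≡⟨ cong (λ b → + 2 * χ b) (does-⇔ (mk⇔ (λ d → ∣m+n∣m⇒∣n d ∣-refl) (∣m∣n⇒∣m+n ∣-refl)) (2 ∣? suc (suc a)) (2 ∣? a)) ⟩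
  + 2 * χ (does (2 ∣? a))
    ≡⟨ even-indicator a ⟩
  1ℤ ^ a + -1ℤ ^ a
    ≡⟨ lemma (1ℤ ^ a) (-1ℤ ^ a) ⟩
  1ℤ ^ suc (suc a) + -1ℤ ^ suc (suc a) ∎
  where
  open ≡-Reasoning

  lemma : ∀ x y → x + y ≡ 1ℤ * (1ℤ * x) + - 1ℤ * (- 1ℤ * y)
  lemma = solve-∀

2N≡eulerian : ∀ n → + 2 * + N n ≡ eulerian 1ℤ n + eulerian -1ℤ n
2N≡eulerian n = begin
  + 2 * + N n
    ≡⟨ cong (_*_ (+ 2)) (length-filter (λ v → unique? _≟_ (toList v) ×-dec (2 ∣? ascents (toList v))) (allVecs n n)) ⟩
  + 2 * sumOver (λ v → χ (isUnique (toList v) ∧ does (2 ∣? ascents (toList v)))) (allVecs n n)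
    ≡⟨ sumOver-*ˡ (+ 2) (λ v → χ (isUnique (toList v) ∧ does (2 ∣? ascents (toList v)))) (allVecs n n) ⟨
  sumOver (λ v → + 2 * χ (isUnique (toList v) ∧ does (2 ∣? ascents (toList v)))) (allVecs n n)
    ≡⟨ sumOver-cong (λ v → pointwise (isUnique (toList v)) (ascents (toList v))) (allVecs n n) ⟩
  sumOver (λ v → weight 1ℤ v + weight -1ℤ v) (allVecs n n)
    ≡⟨ sumOver-+ (weight 1ℤ) (weight -1ℤ) (allVecs n n) ⟩
  eulerian 1ℤ n + eulerian -1ℤ n ∎
  where
  open ≡-Reasoning

  lemma : ∀ a b → + 2 * (a * b) ≡ a * (+ 2 * b)
  lemma = solve-∀

  pointwise : ∀ u a → + 2 * χ (u ∧ does (2 ∣? a)) ≡ χ u * 1ℤ ^ a + χ u * -1ℤ ^ a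
  pointwise u a = begin
    + 2 * χ (u ∧ does (2 ∣? a))      ≡⟨ cong (_*_ (+ 2)) (χ-∧ u _) ⟩
    + 2 * (χ u * χ (does (2 ∣? a)))  ≡⟨ lemma (χ u) _ ⟩
    χ u * (+ 2 * χ (does (2 ∣? a)))  ≡⟨ cong (χ u *_) (even-indicator a) ⟩
    χ u * (1ℤ ^ a + -1ℤ ^ a)         ≡⟨ ℤ.*-distribˡ-+ (χ u) _ _ ⟩
    χ u * 1ℤ ^ a + χ u * -1ℤ ^ a     ∎

-- Sums over initial segments and signed telescoping

sumTo : (ℕ → ℤ) → ℕ → ℤ
sumTo f zero    = 0ℤ
sumTo f (suc n) = sumTo f n + f n

sumTo-suc : ∀ f n → sumTo f (suc n) ≡ f 0 + sumTo (f ∘ suc) n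
sumTo-suc f zero    = trans (ℤ.+-identityˡ (f 0)) (sym (ℤ.+-identityʳ (f 0)))
sumTo-suc f (suc n) = trans (cong (_+ f (suc n)) (sumTo-suc f n)) (ℤ.+-assoc (f 0) _ _)

sum-toℕ : ∀ n f → sum {n} (f ∘ toℕ) ≡ sumTo f n
sum-toℕ zero    f = refl
sum-toℕ (suc n) f = trans (cong (_+_ (f 0)) (sum-toℕ n (f ∘ suc))) (sym (sumTo-suc f n))

sumTo-cong : ∀ {f g} → f ≗ g → sumTo f ≗ sumTo g
sumTo-cong f≗g zero    = refl
sumTo-cong f≗g (suc n) = cong₂ _+_ (sumTo-cong f≗g n) (f≗g n)

sumTo-+ : ∀ f g n → sumTo (λ k → f k + g k) n ≡ sumTo f n + sumTo g n
sumTo-+ f g zero    = refl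
sumTo-+ f g (suc n) = trans (cong (_+ (f n + g n)) (sumTo-+ f g n)) (lemma (sumTo f n) (sumTo g n) (f n) (g n)) where
  lemma : ∀ a b c d → a + b + (c + d) ≡ a + c + (b + d)
  lemma = solve-∀

sumTo-*ˡ : ∀ c f n → sumTo (λ k → c * f k) n ≡ c * sumTo f n
sumTo-*ˡ c f zero    = sym (ℤ.*-zeroʳ c)
sumTo-*ˡ c f (suc n) =
  trans (cong (_+ c * f n) (sumTo-*ˡ c f n)) (sym (ℤ.*-distribˡ-+ c (sumTo f n) (f n)))

sumTo-const : ∀ c n → sumTo (λ _ → c) n ≡ + n * c
sumTo-const c zero    = refl
sumTo-const c (suc n) = trans (cong (_+ c) (sumTo-const c n)) (lemma c (+ n)) where
  lemma : ∀ c m → m * c + c ≡ (1ℤ + m) * c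
  lemma = solve-∀

-- The sign is the one in the recursion of `eulerianFrom` at -1 for the first letter `i`: plus for
-- `j < i`, minus from `j = i` on.
signedTelescope : (ℕ → ℤ) → ℕ → ℕ → ℤ
signedTelescope D i j = -1ℤ ^ ⟦ i < suc j ⟧ * (D (suc j) - D j)

sumTo-signedTelescope-≤ : ∀ D i n → n ℕ.≤ i → sumTo (signedTelescope D i) n ≡ D n - D 0
sumTo-signedTelescope-≤ D i zero    _   = lemma (D 0) where
  lemma : ∀ a → 0ℤ ≡ a - a
  lemma = solve-∀
sumTo-signedTelescope-≤ D i (suc n) n<i
  rewrite sumTo-signedTelescope-≤ D i n (ℕ.<⇒≤ n<i)
        | dec-false (i ℕ.<? suc n) (λ i≤n → ℕ.<⇒≱ n<i (ℕ.≤-pred i≤n))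
  = lemma (D 0) (D n) (D (suc n)) where
  lemma : ∀ a b c → (b - a) + 1ℤ * (c - b) ≡ c - a
  lemma = solve-∀

-- The increments are added from `D 0` to `D i` and subtracted from there to the end, so the turning
-- point `D i` counts twice.
sumTo-signedTelescope : ∀ D i m →
  sumTo (signedTelescope D i) (m ℕ.+ i) ≡ + 2 * D i - (D 0 + D (m ℕ.+ i))
sumTo-signedTelescope D i zero    = trans (sumTo-signedTelescope-≤ D i i ℕ.≤-refl) (lemma (D 0) (D i)) where
  lemma : ∀ a b → b - a ≡ + 2 * b - (a + b)
  lemma = solve-∀
sumTo-signedTelescope D i (suc m)
  rewrite sumTo-signedTelescope D i m
        | dec-true (i ℕ.<? suc (m ℕ.+ i)) (s≤s (ℕ.m≤n+m i m))
  = lemma (D 0) (D i) (D (m ℕ.+ i)) (D (suc m ℕ.+ i)) where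
  lemma : ∀ a b c d → + 2 * b - (a + c) + - 1ℤ * 1ℤ * (d - c) ≡ + 2 * b - (a + d)
  lemma = solve-∀

-- Finite differences

Δ^ : ℕ → (ℕ → ℤ) → ℕ → ℤ
Δ^ zero    f x = f x
Δ^ (suc n) f x = Δ^ n f (suc x) - Δ^ n f x

Δ^-shift : ∀ n f x → Δ^ n (f ∘ suc) x ≡ Δ^ n f (suc x)
Δ^-shift zero    f x = refl
Δ^-shift (suc n) f x = cong₂ _-_ (Δ^-shift n f (suc x)) (Δ^-shift n f x)

-- `sumTo f` is a discrete antiderivative of `f`. This trades a difference of order `p` in Newton's
-- formula for one of order `p - 1`.
Δ^-sumTo : ∀ n f x → Δ^ (suc n) (sumTo f) x ≡ Δ^ n f x
Δ^-sumTo zero    f x = lemma (sumTo f x) (f x) where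
  lemma : ∀ a b → a + b - a ≡ b
  lemma = solve-∀
Δ^-sumTo (suc n) f x = cong₂ _-_ (Δ^-sumTo n f (suc x)) (Δ^-sumTo n f x)

-- Exponentials are eigenfunctions of the difference operator, with eigenvalue `a - 1`.
Δ^-^ : ∀ a n x → Δ^ n (a ^_) x ≡ (a - 1ℤ) ^ n * a ^ x
Δ^-^ a zero    x = sym (ℤ.*-identityˡ (a ^ x))
Δ^-^ a (suc n) x = trans (cong₂ _-_ (Δ^-^ a n (suc x)) (Δ^-^ a n x)) (lemma a ((a - 1ℤ) ^ n) (a ^ x)) where
  lemma : ∀ a b c → b * (a * c) - b * c ≡ (a - 1ℤ) * b * c
  lemma = solve-∀

Δ^-leibniz : ∀ n f x → Δ^ (suc n) (λ y → + y * f y) x ≡ + x * Δ^ (suc n) f x + + suc n * Δ^ n f (suc x)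
Δ^-leibniz zero    f x = lemma (+ x) (f x) (f (suc x)) where
  lemma : ∀ x a b → (1ℤ + x) * b - x * a ≡ x * (b - a) + 1ℤ * b
  lemma = solve-∀
Δ^-leibniz (suc n) f x =
  trans (cong₂ _-_ (Δ^-leibniz n f (suc x)) (Δ^-leibniz n f x))
        (lemma (+ x) (+ n) (Δ^ n f (suc x)) (Δ^ n f (suc (suc x))) (Δ^ (suc n) f x)) where
  lemma : ∀ x n a b c → ((1ℤ + x) * (b - a) + (1ℤ + n) * b) - (x * c + (1ℤ + n) * a) ≡
                        x * ((b - a) - c) + (1ℤ + (1ℤ + n)) * (b - a)
  lemma = solve-∀

-- By induction the `n`-th difference of the `n`-th power is constant, so the first Leibniz term
-- vanishes and the second multiplies `n !` by `suc n`.
Δ^-monomial : ∀ n x → Δ^ n (λ y → (+ y) ^ n) x ≡ + (n !)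
Δ^-monomial zero    x = refl
Δ^-monomial (suc n) x = begin
  Δ^ (suc n) (λ y → + y * (+ y) ^ n) x
    ≡⟨ Δ^-leibniz n (λ y → (+ y) ^ n) x ⟩
  + x * (Δ^ n (λ y → (+ y) ^ n) (suc x) - Δ^ n (λ y → (+ y) ^ n) x) + + suc n * Δ^ n (λ y → (+ y) ^ n) (suc x)
    ≡⟨ cong₂ (λ a b → + x * (b - a) + + suc n * b) (Δ^-monomial n x) (Δ^-monomial n (suc x)) ⟩
  + x * (+ (n !) - + (n !)) + + suc n * + (n !)
    ≡⟨ lemma (+ x) (+ (n !)) (+ suc n) ⟩
  + suc n * + (n !)
    ≡⟨ ℤ.pos-* (suc n) (n !) ⟨
  + (suc n !) ∎
  where
  open ≡-Reasoning

  lemma : ∀ x a b → x * (a - a) + b * a ≡ b * a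
  lemma = solve-∀

nC0≡1 : ∀ n → n C 0 ≡ 1
nC0≡1 n = trans (nCk≡nC[n∸k] {0} {n} z≤n) (nCn≡1 n)

-- Induction on `n` for all `f` at once: the formula is applied to `f ∘ suc`, each difference at 1
-- is the one at 0 plus the next one at 0, and Pascal's rule collects the coefficients.
newton : ∀ n f → f n ≡ sumTo (λ k → + (n C k) * Δ^ k f 0) (suc n)
newton zero    f = lemma (f 0) where
  lemma : ∀ a → a ≡ 0ℤ + 1ℤ * a
  lemma = solve-∀
newton (suc n) f = begin
  f (suc n)
    ≡⟨ newton n (f ∘ suc) ⟩
  sumTo (λ k → c k * Δ^ k (f ∘ suc) 0) (suc n)
    ≡⟨ sumTo-cong (λ k → trans (cong (c k *_) (Δ^-shift k f 0)) (lemma₁ (c k) (d k) (Δ^ k f 1))) (suc n) ⟩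
  sumTo (λ k → c k * d k + c k * d (suc k)) (suc n)
    ≡⟨ sumTo-+ (λ k → c k * d k) (λ k → c k * d (suc k)) (suc n) ⟩
  sumTo (λ k → c k * d k) (suc n) + T
    -- Since `n C suc n = 0`, a term can be appended; splitting off the first term then leaves two
    -- sums with the same range.
    ≡⟨ cong (_+ T) (sym (trans (cong (λ m → sumTo (λ k → c k * d k) (suc n) + + m * d (suc n))
                                     (k>n⇒nCk≡0 (ℕ.n<1+n n)))
                               (ℤ.+-identityʳ (sumTo (λ k → c k * d k) (suc n))))) ⟩
  sumTo (λ k → c k * d k) (suc (suc n)) + T
    ≡⟨ cong (_+ T) (sumTo-suc (λ k → c k * d k) (suc n)) ⟩
  c 0 * d 0 + sumTo (λ k → c (suc k) * d (suc k)) (suc n) + T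
    ≡⟨ lemma₂ (c 0 * d 0) _ T ⟩
  c 0 * d 0 + (T + sumTo (λ k → c (suc k) * d (suc k)) (suc n))
    ≡⟨ cong₂ (λ m s → + m * d 0 + s) (trans (nC0≡1 n) (sym (nC0≡1 (suc n))))
             (trans (sym (sumTo-+ (λ k → c k * d (suc k)) (λ k → c (suc k) * d (suc k)) (suc n)))
                    (sumTo-cong pascal (suc n))) ⟩
  + (suc n C 0) * d 0 + sumTo (λ k → + (suc n C suc k) * d (suc k)) (suc n)
    ≡⟨ sumTo-suc (λ k → + (suc n C k) * d k) (suc n) ⟨
  sumTo (λ k → + (suc n C k) * d k) (suc (suc n)) ∎
  where
  open ≡-Reasoning

  c d : ℕ → ℤ
  c k = + (n C k)
  d k = Δ^ k f 0

  T : ℤ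
  T = sumTo (λ k → c k * d (suc k)) (suc n)

  lemma₁ : ∀ c a b → c * b ≡ c * a + c * (b - a)
  lemma₁ = solve-∀

  lemma₂ : ∀ a b c → a + b + c ≡ a + (c + b)
  lemma₂ = solve-∀

  lemma₃ : ∀ a b c → a * c + b * c ≡ (a + b) * c
  lemma₃ = solve-∀

  pascal : ∀ k → c k * d (suc k) + c (suc k) * d (suc k) ≡ + (suc n C suc k) * d (suc k)
  pascal k = trans (lemma₃ (c k) (c (suc k)) (d (suc k)))
                   (cong (λ m → + m * d (suc k)) (nCk+nC[k+1]≡[n+1]C[k+1] n k))

-- Congruences

module Modulo (p : ℕ) where

  infix 4 _≈_
  -- The record wrapper keeps `a` and `b` inferable from a proof, which bare divisibility of `a - b`
  -- would not.
  record _≈_ (a b : ℤ) : Set where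
    constructor congruent
    field p∣a-b : + p ∣ℤ a - b
  open _≈_ public

  private
    via : ∀ {a b c} → c ≡ a - b → + p ∣ℤ c → a ≈ b
    via refl d = congruent d

    ≈-refl′ : ∀ {a} → a ≈ a
    ≈-refl′ {a} = congruent (divides 0ℤ (ℤ.+-inverseʳ a))

    ≡⇒≈′ : ∀ {a b} → a ≡ b → a ≈ b
    ≡⇒≈′ refl = ≈-refl′

  commutativeRing : CommutativeRing 0ℓ 0ℓ
  commutativeRing = record
    { Carrier = ℤ
    ; _≈_ = _≈_
    ; _+_ = _+_
    ; _*_ = _*_
    ; -_ = -_
    ; 0# = 0ℤ
    ; 1# = 1ℤ
    ; isCommutativeRing = record
      { isRing = record
        { +-isAbelianGroup = record
          { isGroup = record
            { isMonoid = record
              { isSemigroup = record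
                { isMagma = record
                  { isEquivalence = record
                    { refl = ≈-refl′
                    ; sym = λ {a} {b} (congruent d) → via (lemma-sym a b) (∣ℤ-neg d)
                    ; trans = λ {a} {b} {c} (congruent d) (congruent e) → via (lemma-trans a b c) (∣ℤ-+ d e)
                    }
                  ; ∙-cong = λ {a} {b} {c} {d} (congruent x) (congruent y) → via (lemma-+ a b c d) (∣ℤ-+ x y)
                  }
                ; assoc = λ a b c → ≡⇒≈′ (ℤ.+-assoc a b c)
                }
              ; identity = (λ a → ≡⇒≈′ (ℤ.+-identityˡ a)) , (λ a → ≡⇒≈′ (ℤ.+-identityʳ a))
              }
            ; inverse = (λ a → ≡⇒≈′ (ℤ.+-inverseˡ a)) , (λ a → ≡⇒≈′ (ℤ.+-inverseʳ a))
            ; ⁻¹-cong = λ {a} {b} (congruent d) → via (lemma-neg a b) (∣ℤ-neg d)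
            }
          ; comm = λ a b → ≡⇒≈′ (ℤ.+-comm a b)
          }
        ; *-cong = λ {a} {b} {c} {d} (congruent x) (congruent y) →
            via (lemma-* a b c d) (∣ℤ-+ (∣ℤ-* c x) (∣ℤ-* b y))
        ; *-assoc = λ a b c → ≡⇒≈′ (ℤ.*-assoc a b c)
        ; *-identity = (λ a → ≡⇒≈′ (ℤ.*-identityˡ a)) , (λ a → ≡⇒≈′ (ℤ.*-identityʳ a))
        ; distrib = (λ a b c → ≡⇒≈′ (ℤ.*-distribˡ-+ a b c)) , (λ a b c → ≡⇒≈′ (ℤ.*-distribʳ-+ a b c))
        }
      ; *-comm = λ a b → ≡⇒≈′ (ℤ.*-comm a b)
      }
    }
    where
    lemma-sym : ∀ a b → - (a - b) ≡ b - a
    lemma-sym = solve-∀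
    lemma-trans : ∀ a b c → (a - b) + (b - c) ≡ a - c
    lemma-trans = solve-∀
    lemma-+ : ∀ a b c d → (a - b) + (c - d) ≡ (a + c) - (b + d)
    lemma-+ = solve-∀
    lemma-neg : ∀ a b → - (a - b) ≡ (- a) - (- b)
    lemma-neg = solve-∀
    lemma-* : ∀ a b c d → c * (a - b) + b * (c - d) ≡ a * c - b * d
    lemma-* = solve-∀

  open CommutativeRing commutativeRing public
    using (setoid; +-cong; *-cong; -‿cong; +-congˡ; +-congʳ; *-congˡ; *-congʳ)
    renaming (refl to ≈-refl; sym to ≈-sym; trans to ≈-trans; reflexive to ≡⇒≈)

  ^-cong : ∀ {a b} n → a ≈ b → a ^ n ≈ b ^ n
  ^-cong zero    a≈b = ≈-refl
  ^-cong (suc n) a≈b = *-cong a≈b (^-cong n a≈b)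

  ∣⇒≈0 : ∀ {m} → p ∣ m → + m ≈ 0ℤ
  ∣⇒≈0 {m} p∣m = congruent (subst (+ p ∣ℤ_) (sym (ℤ.+-identityʳ (+ m))) (∣ᵤ⇒∣ p∣m))

  p≈0 : + p ≈ 0ℤ
  p≈0 = ∣⇒≈0 ∣-refl

  sumTo-≈ : ∀ {f g} n → (∀ k → k ℕ.< n → f k ≈ g k) → sumTo f n ≈ sumTo g n
  sumTo-≈ zero    f≈g = ≈-refl
  sumTo-≈ (suc n) f≈g = +-cong (sumTo-≈ n (λ k k<n → f≈g k (ℕ.m<n⇒m<1+n k<n))) (f≈g n ℕ.≤-refl)

-- Signs, alternating sums and reindexing

-1^[m+m]≡1 : ∀ m → -1ℤ ^ (m ℕ.+ m) ≡ 1ℤ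
-1^[m+m]≡1 zero    = refl
-1^[m+m]≡1 (suc m) rewrite ℕ.+-suc m m | -1^[m+m]≡1 m = refl

neg-^ : ∀ a n → (- a) ^ n ≡ -1ℤ ^ n * a ^ n
neg-^ a zero    = refl
neg-^ a (suc n) = trans (cong ((- a) *_) (neg-^ a n)) (lemma a (-1ℤ ^ n) (a ^ n)) where
  lemma : ∀ a s b → (- a) * (s * b) ≡ (- 1ℤ * s) * (a * b)
  lemma = solve-∀

alternating : (ℕ → ℤ) → ℕ → ℤ
alternating f = sumTo (λ k → -1ℤ ^ k * f k)

alternating-cong : ∀ {f g} → f ≗ g → alternating f ≗ alternating g
alternating-cong f≗g = sumTo-cong (λ k → cong (-1ℤ ^ k *_) (f≗g k))

alternating-minus : ∀ f g n → alternating f n - alternating g n ≡ alternating (λ k → f k - g k) n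
alternating-minus f g zero    = refl
alternating-minus f g (suc n) =
  trans (lemma (alternating f n) (alternating g n) (-1ℤ ^ n) (f n) (g n))
        (cong (_+ -1ℤ ^ n * (f n - g n)) (alternating-minus f g n))
  where
  lemma : ∀ a b s x y → a + s * x - (b + s * y) ≡ a - b + s * (x - y)
  lemma = solve-∀

-- The terms `(-1)^k (f k + f (k + 1))` telescope.
alternating-shift : ∀ f n → alternating f n + alternating (f ∘ suc) n ≡ f 0 - -1ℤ ^ n * f n
alternating-shift f zero    = lemma (f 0) where
  lemma : ∀ a → 0ℤ ≡ a - 1ℤ * a
  lemma = solve-∀
alternating-shift f (suc n) =
  trans (lemma₁ (alternating f n) (alternating (f ∘ suc) n) (-1ℤ ^ n) (f n) (f (suc n)))
        (trans (cong (_+ (-1ℤ ^ n * f n + -1ℤ ^ n * f (suc n))) (alternating-shift f n))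
               (lemma₂ (f 0) (-1ℤ ^ n) (f n) (f (suc n))))
  where
  lemma₁ : ∀ a b s x y → a + s * x + (b + s * y) ≡ a + b + (s * x + s * y)
  lemma₁ = solve-∀
  lemma₂ : ∀ a s x y → a - s * x + (s * x + s * y) ≡ a - - 1ℤ * s * y
  lemma₂ = solve-∀

^-distribʳ-* : ∀ a b n → (a * b) ^ n ≡ a ^ n * b ^ n
^-distribʳ-* a b zero    = refl
^-distribʳ-* a b (suc n) = trans (cong (a * b *_) (^-distribʳ-* a b n)) (lemma a b (a ^ n) (b ^ n)) where
  lemma : ∀ a b x y → a * b * (x * y) ≡ a * x * (b * y)
  lemma = solve-∀

-- With `x` and `y` the two powers, `y * y = 1` and `x * y = 1`, so
-- `x = x * (1 - y * y) + x * y * y` collapses to `y`.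
-1^-parity : ∀ {a b m} → a ℕ.+ b ≡ m ℕ.+ m → -1ℤ ^ a ≡ -1ℤ ^ b
-1^-parity {a} {b} {m} eq = trans (lemma (-1ℤ ^ a) (-1ℤ ^ b)) (trans
  (cong₂ (λ x y → -1ℤ ^ a * (1ℤ - x) + y * -1ℤ ^ b)
         (trans (sym (ℤ.^-distribˡ-+-* -1ℤ b b)) (-1^[m+m]≡1 b))
         (trans (sym (ℤ.^-distribˡ-+-* -1ℤ a b)) (trans (cong (-1ℤ ^_) eq) (-1^[m+m]≡1 m))))
  (lemma′ (-1ℤ ^ a) (-1ℤ ^ b)))
  where
  lemma : ∀ x y → x ≡ x * (1ℤ - y * y) + x * y * y
  lemma = solve-∀
  lemma′ : ∀ x y → x * (1ℤ - 1ℤ) + 1ℤ * y ≡ y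
  lemma′ = solve-∀

sumTo-reverse : ∀ f n → sumTo f n ≡ sumTo (λ k → f (n ∸ suc k)) n
sumTo-reverse f zero    = refl
sumTo-reverse f (suc n) = trans (ℤ.+-comm (sumTo f n) (f n))
  (trans (cong (_+_ (f n)) (sumTo-reverse f n)) (sym (sumTo-suc (λ k → f (n ∸ k)) n)))

sumTo-split : ∀ f m n → sumTo f (n ℕ.+ m) ≡ sumTo f m + sumTo (λ k → f (k ℕ.+ m)) n
sumTo-split f m zero    = sym (ℤ.+-identityʳ (sumTo f m))
sumTo-split f m (suc n) = trans (cong (_+ f (n ℕ.+ m)) (sumTo-split f m n)) (ℤ.+-assoc (sumTo f m) _ _)

-- Index `k` is paired with `2 n - 1 - k`. For a shifted function `f ∘ suc` the paired arguments add
-- up to `2 n + 1`, so with `p = 2 n + 1` this is the reflection of `j` to `p - j`.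
sumTo-fold : ∀ f n → sumTo f (n ℕ.+ n) ≡ sumTo (λ k → f k + f ((n ∸ suc k) ℕ.+ n)) n
sumTo-fold f n = trans (sumTo-split f n n) (trans
  (cong (_+_ (sumTo f n)) (sumTo-reverse (λ k → f (k ℕ.+ n)) n))
  (sym (sumTo-+ f (λ k → f ((n ∸ suc k) ℕ.+ n)) n)))

-- Odd positions carry a minus sign, and adding their terms twice turns it into a plus. For
-- `inverse ∘ suc` these positions hold the even arguments.
alternating-double : ∀ f n →
  alternating f (n ℕ.+ n) + + 2 * sumTo (λ i → f (suc (i ℕ.+ i))) n ≡ sumTo f (n ℕ.+ n)
alternating-double f zero    = refl
alternating-double f (suc n) rewrite ℕ.+-suc n n | -1^[m+m]≡1 n =
  trans (lemma (alternating f (n ℕ.+ n)) (sumTo (λ i → f (suc (i ℕ.+ i))) n) (f (n ℕ.+ n)) (f (suc (n ℕ.+ n))))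
        (cong (λ s → s + f (n ℕ.+ n) + f (suc (n ℕ.+ n))) (alternating-double f n))
  where
  lemma : ∀ a s x y → a + 1ℤ * x + - 1ℤ * 1ℤ * y + + 2 * (s + y) ≡ a + + 2 * s + x + y
  lemma = solve-∀

-- A largest letter put in front creates no ascent, so `eulerianFrom t n n`, although it concerns
-- permutations of `n + 1` letters, is the whole polynomial for `n` letters.
eulerian-last : ∀ t n → eulerian t n ≡ eulerianFrom t n n
eulerian-last t zero    = refl
eulerian-last t (suc m) = trans (eulerian-suc t m) (sum-cong-≗ {suc m} (λ j → sym (no-ascent j))) where
  no-ascent : ∀ (j : Fin (suc m)) → t ^ ⟦ suc m < suc (toℕ j) ⟧ * eulerianFrom t m (toℕ j) ≡ eulerianFrom t m (toℕ j)
  no-ascent j rewrite dec-false (m ℕ.<? toℕ j) (ℕ.≤⇒≯ (ℕ.≤-pred (toℕ<n j))) = ℤ.*-identityˡ _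

-- Arithmetic modulo a prime: Fermat and Wilson

module PrimeModulus {q} (pr : Prime (suc q)) where

  private
    p : ℕ
    p = suc q
  open Modulo p
  open SetoidReasoning setoid

  p∤ : ∀ {k} .{{_ : NonZero k}} → k ℕ.< p → ¬ (p ∣ k)
  p∤ k<p p∣k = ℕ.<⇒≱ k<p (∣⇒≤ p∣k)

  *-cancelˡ-≈ : ∀ {c a b} → ¬ (p ∣ c) → + c * a ≈ + c * b → a ≈ b
  *-cancelˡ-≈ {c} {a} {b} p∤c (congruent d) =
    congruent (∣ᵤ⇒∣ ([ (λ p∣c → contradiction p∣c p∤c) , (λ p∣a-b → p∣a-b) ]′
      (euclidsLemma c ∣ a - b ∣ pr (subst (p ∣_) (trans (cong ∣_∣ (lemma (+ c) a b)) (ℤ.abs-* (+ c) (a - b))) (∣⇒∣ᵤ d)))))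
    where
    lemma : ∀ c a b → c * a - c * b ≡ c * (a - b)
    lemma = solve-∀

  p∤1 : ¬ (p ∣ 1)
  p∤1 = p∤ (ℕ.nonTrivial⇒n>1 p {{prime⇒nonTrivial pr}})

  p∤! : ∀ {k} → k ℕ.< p → ¬ (p ∣ k !)
  p∤! {zero}  k<p = p∤1
  p∤! {suc k} k<p p∣k! = [ p∤ k<p , p∤! (ℕ.<-trans (ℕ.n<1+n k) k<p) ]′ (euclidsLemma (suc k) (k !) pr p∣k!)

  -- `p` divides `p ! = (p C k) * (k ! * (p ∸ k) !)` but neither of the two factorials, whose
  -- arguments are below `p`.
  p∣pCk : ∀ k .{{_ : NonZero k}} → k ℕ.< p → p ∣ p C k
  p∣pCk k@(suc k′) k<p =
    [ (λ p∣pCk → p∣pCk)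
    , (λ p∣k!d! → ⊥-elim ([ p∤! k<p , p∤! (s≤s (ℕ.m∸n≤m q k′)) ]′ (euclidsLemma (k !) ((p ∸ k) !) pr p∣k!d!)))
    ]′ (euclidsLemma (p C k) (k ! ℕ.* (p ∸ k) !) pr (subst (p ∣_) (sym quotient) (m∣m*n (q !))))
    where
    instance _ = k ℕ.!* (p ∸ k) !≢0
    quotient : (p C k) ℕ.* (k ! ℕ.* (p ∸ k) !) ≡ p !
    quotient = trans (cong (ℕ._* (k ! ℕ.* (p ∸ k) !)) (nCk≡n!/k![n-k]! (ℕ.<⇒≤ k<p)))
                     (m/n*n≡m (k![n∸k]!∣n! (ℕ.<⇒≤ k<p)))

  -- Only the coefficients `p C 0` and `p C p` survive modulo `p`.
  newton-≈ : ∀ f → f p ≈ f 0 + Δ^ p f 0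
  newton-≈ f = begin
    f p                                           ≡⟨ newton p f ⟩
    sumTo term p + term p                         ≡⟨ cong (_+ term p) (sumTo-suc term q) ⟩
    term 0 + sumTo (term ∘ suc) q + term p        ≈⟨ +-cong (+-cong head≈ middle≈) last≈ ⟩
    f 0 + 0ℤ + Δ^ p f 0                           ≡⟨ cong (_+ Δ^ p f 0) (ℤ.+-identityʳ (f 0)) ⟩
    f 0 + Δ^ p f 0                                ∎
    where
    term : ℕ → ℤ
    term k = + (p C k) * Δ^ k f 0

    head≈ : term 0 ≈ f 0
    head≈ = ≡⇒≈ (trans (cong (λ m → + m * f 0) (nC0≡1 p)) (ℤ.*-identityˡ (f 0)))

    last≈ : term p ≈ Δ^ p f 0
    last≈ = ≡⇒≈ (trans (cong (λ m → + m * Δ^ p f 0) (nCn≡1 p)) (ℤ.*-identityˡ (Δ^ p f 0)))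

    middle≈ : sumTo (term ∘ suc) q ≈ 0ℤ
    middle≈ = ≈-trans
      (sumTo-≈ {g = λ _ → 0ℤ} q (λ k k<q → *-congʳ {Δ^ (suc k) f 0} (∣⇒≈0 (p∣pCk (suc k) (s≤s k<q)))))
      (≡⇒≈ (trans (sumTo-const 0ℤ q) (ℤ.*-zeroʳ (+ q))))

  -- Induction through the exponential with base `n + 1`: its value at 0 is 1 and its `p`-th
  -- difference there is `n ^ p`, so Newton's formula gives `(n + 1)^p ≈ 1 + n^p`.
  n^p≈n : ∀ n → (+ n) ^ p ≈ + n
  n^p≈n zero    = ≈-refl
  n^p≈n (suc n) = begin
    (+ suc n) ^ p                    ≈⟨ newton-≈ ((+ suc n) ^_) ⟩
    1ℤ + Δ^ p ((+ suc n) ^_) 0       ≡⟨ cong (_+_ 1ℤ) (Δ^-^ (+ suc n) p 0) ⟩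
    1ℤ + (+ n) ^ p * 1ℤ              ≡⟨ cong (_+_ 1ℤ) (ℤ.*-identityʳ ((+ n) ^ p)) ⟩
    1ℤ + (+ n) ^ p                   ≈⟨ +-congˡ {1ℤ} (n^p≈n n) ⟩
    + suc n                          ∎

  fermat : ∀ n .{{_ : NonZero n}} → n ℕ.< p → (+ n) ^ q ≈ 1ℤ
  fermat n n<p = *-cancelˡ-≈ (p∤ n<p) (≈-trans (n^p≈n n) (≡⇒≈ (sym (ℤ.*-identityʳ (+ n)))))

  -- Newton's formula is applied to the partial sums of `k ^ q`: their value at `p` is `p - 1` by
  -- Fermat, and their `p`-th difference at 0 is the `q`-th difference of `k ^ q`, which is `q !`.
  wilson : .{{_ : NonZero q}} → + (q !) ≈ -1ℤ
  wilson = begin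
    + (q !)                                    ≡⟨ Δ^-monomial q 0 ⟨
    Δ^ q f 0                                   ≡⟨ Δ^-sumTo q f 0 ⟨
    Δ^ p (sumTo f) 0                           ≡⟨ ℤ.+-identityˡ (Δ^ p (sumTo f) 0) ⟨
    0ℤ + Δ^ p (sumTo f) 0                      ≈⟨ newton-≈ (sumTo f) ⟨
    sumTo f p                                  ≡⟨ sumTo-suc f q ⟩
    0ℤ ^ q + sumTo (f ∘ suc) q                 ≈⟨ +-cong (≡⇒≈ (0^ q)) (sumTo-≈ q (λ k k<q → fermat (suc k) (s≤s k<q))) ⟩
    0ℤ + sumTo (λ _ → 1ℤ) q                    ≡⟨ cong (_+_ 0ℤ) (sumTo-const 1ℤ q) ⟩
    0ℤ + + q * 1ℤ                              ≡⟨ lemma (+ q) ⟩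
    + p - 1ℤ                                   ≈⟨ +-congʳ { -1ℤ} p≈0 ⟩
    -1ℤ                                        ∎
    where
    f : ℕ → ℤ
    f k = (+ k) ^ q

    0^ : ∀ n .{{_ : NonZero n}} → 0ℤ ^ n ≡ 0ℤ
    0^ (suc n) = refl

    lemma : ∀ a → 0ℤ + a * 1ℤ ≡ 1ℤ + a - 1ℤ
    lemma = solve-∀

  -- Residues of p-integral rationals

  -- The image of a p-integral rational in ℤ/p is the class of a.
  infix 4 _↦_
  record _↦_ (r : ℚ) (a : ℤ) : Set where
    constructor residue
    field
      p∤↧   : ¬ (p ∣ ↧ₙ r)
      ↥≈a*↧ : ↥ r ≈ a * ↧ r

  p∤* : ∀ {c d} → ¬ (p ∣ c) → ¬ (p ∣ d) → ¬ (p ∣ c ℕ.* d)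
  p∤* {c} {d} p∤c p∤d p∣cd = [ p∤c , p∤d ]′ (euclidsLemma c d pr p∣cd)

  -- A residue may be read off any representative whose denominator is prime to `p`. Were the
  -- reduced denominator divisible by `p`, cross-multiplication would make `p` divide the reduced
  -- numerator too, against coprimality.
  fraction-↦ : ∀ {r a} x {d} → toℚᵘ r ℚᵘ.≃ ℚᵘ.mkℚᵘ x d → ¬ (p ∣ suc d) → x ≈ a * + suc d → r ↦ a
  fraction-↦ {r@(mkℚ _ _ coprime)} {a} x {d} (ℚᵘ.*≡* eq) p∤d x≈ad = residue p∤↧r (*-cancelˡ-≈ p∤d (begin
    + suc d * ↥ r          ≡⟨ trans (ℤ.*-comm (+ suc d) (↥ r)) eq ⟩
    x * ↧ r                ≈⟨ *-congʳ {↧ r} x≈ad ⟩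
    a * + suc d * ↧ r      ≡⟨ lemma a (+ suc d) (↧ r) ⟩
    + suc d * (a * ↧ r)    ∎))
    where
    lemma : ∀ a b c → a * b * c ≡ b * (a * c)
    lemma = solve-∀

    p∣↥d : p ∣ ↧ₙ r → p ∣ ∣ ↥ r ∣ ℕ.* suc d
    p∣↥d p∣↧r = subst (p ∣_)
      (trans (sym (ℤ.abs-* x (↧ r))) (trans (cong ∣_∣ (sym eq)) (ℤ.abs-* (↥ r) (+ suc d))))
      (∣n⇒∣m*n ∣ x ∣ p∣↧r)

    p∤↧r : ¬ (p ∣ ↧ₙ r)
    p∤↧r p∣↧r =
      [ (λ p∣↥r → ℕ.nonTrivial⇒≢1 {{prime⇒nonTrivial pr}} (Coprime.recompute coprime (p∣↥r , p∣↧r)))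
      , p∤d
      ]′ (euclidsLemma ∣ ↥ r ∣ (suc d) pr (p∣↥d p∣↧r))

  /-↦ : ∀ {a} x d .{{_ : NonZero d}} → ¬ (p ∣ d) → x ≈ a * + d → (x ℚ./ d) ↦ a
  /-↦ x (suc d) p∤d = fraction-↦ x (ℚ.toℚᵘ-fromℚᵘ (ℚᵘ.mkℚᵘ x d)) p∤d

  0ℚ↦0 : ℚ.0ℚ ↦ 0ℤ
  0ℚ↦0 = residue p∤1 ≈-refl

  +-↦ : ∀ {r s a b} → r ↦ a → s ↦ b → (r ℚ.+ s) ↦ (a + b)
  +-↦ {r@record{}} {s@record{}} {a} {b} (residue p∤r r≈a) (residue p∤s s≈b) =
    fraction-↦ (↥ r * ↧ s + ↥ s * ↧ r) (ℚ.toℚᵘ-homo-+ r s) (p∤* p∤r p∤s) (begin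
      ↥ r * ↧ s + ↥ s * ↧ r                      ≈⟨ +-cong (*-congʳ {↧ s} r≈a) (*-congʳ {↧ r} s≈b) ⟩
      a * ↧ r * ↧ s + b * ↧ s * ↧ r              ≡⟨ lemma a b (↧ r) (↧ s) ⟩
      (a + b) * (↧ r * ↧ s)                      ≡⟨ cong ((a + b) *_) (ℤ.pos-* (↧ₙ r) (↧ₙ s)) ⟨
      (a + b) * + (↧ₙ r ℕ.* ↧ₙ s)                ∎)
    where
    lemma : ∀ a b c d → a * c * d + b * d * c ≡ (a + b) * (c * d)
    lemma = solve-∀

  neg-↦ : ∀ {r a} → r ↦ a → (ℚ.- r) ↦ (- a)
  neg-↦ {r@record{}} {a} (residue p∤r r≈a) =
    fraction-↦ (- ↥ r) (ℚ.toℚᵘ-homo‿- r) p∤r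
               (≈-trans (-‿cong r≈a) (≡⇒≈ (ℤ.neg-distribˡ-* a (↧ r))))

  ↦-≡modℚ : ∀ {r s a} → r ↦ a → s ↦ a → r ≡ s [modℚ p ]
  ↦-≡modℚ {r} {s} {a} r↦a@(residue p∤r _) s↦a@(residue p∤s _) with +-↦ r↦a (neg-↦ s↦a)
  ... | residue _ r-s≈ = p∤r , p∤s , ∣⇒∣ᵤ (subst (+ p ∣ℤ_) (ℤ.+-identityʳ (↥ (r ℚ.- s)))
    (p∣a-b (≈-trans r-s≈ (≡⇒≈ (cong (_* ↧ (r ℚ.- s)) (ℤ.+-inverseʳ a))))))

-- The Eulerian value at -1 modulo an odd prime

module OddPrime {h′} (pr : Prime (suc (suc h′ ℕ.+ suc h′))) where

  private
    -- `suc n` is `h + h` by computation, so the evenness of `p - 1` is available without any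
    -- subtraction.
    h n p : ℕ
    h = suc h′
    n = h′ ℕ.+ h
    p = suc (suc n)

  open Modulo p
  open PrimeModulus pr
  open SetoidReasoning setoid

  2<p : 2 ℕ.< p
  2<p = s≤s (s≤s (ℕ.≤-trans (s≤s z≤n) (ℕ.m≤n+m h h′)))

  *-cancelˡ-2 : ∀ {a b} → + 2 * a ≈ + 2 * b → a ≈ b
  *-cancelˡ-2 = *-cancelˡ-≈ (p∤ 2<p)

  -1^p : -1ℤ ^ p ≡ -1ℤ
  -1^p = cong (-1ℤ *_) (-1^[m+m]≡1 h)

  -- `p` is odd, so the boundary term at `p` enters with a plus sign.
  alternating-shift-≈ : ∀ f → alternating f p + alternating (f ∘ suc) p ≈ f 0 + f p
  alternating-shift-≈ f = ≡⇒≈ (trans (alternating-shift f p)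
    (trans (cong (λ s → f 0 - s * f p) -1^p) (lemma (f 0) (f p))))
    where
    lemma : ∀ a b → a - - 1ℤ * b ≡ a + b
    lemma = solve-∀

  monomial : ℕ → ℕ → ℕ → ℤ
  monomial m i k = (+ suc k) ^ i * (+ k) ^ (m ∸ i)

  -- Modulo p the functional L f = Σ_{k<p} (-1)^k f(k) satisfies
  -- L f + L (f ∘ suc) = 2 f(0) on polynomials f.  Hence 2^m L ((k+1)^i k^(m-i))
  -- obeys the recursion of eulerianFrom -1ℤ: the factor k+1 minus the factor k
  -- is 1, so the signed sum over first letters telescopes.
  scaledSum : ℕ → ℕ → ℤ
  scaledSum m i = (+ 2) ^ m * alternating (monomial m i) p

  -- The two monomials are `monomial m j` times `k + 1` and times `k`; the factor 2 is the extra
  -- power of two in the scaling.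
  scaledSum-step : ∀ m j → j ℕ.≤ m → scaledSum (suc m) (suc j) - scaledSum (suc m) j ≡ + 2 * scaledSum m j
  scaledSum-step m j j≤m =
    trans (lemma₁ ((+ 2) ^ m) (alternating (monomial (suc m) (suc j)) p) (alternating (monomial (suc m) j) p))
          (cong (λ s → + 2 * ((+ 2) ^ m * s))
                (trans (alternating-minus (monomial (suc m) (suc j)) (monomial (suc m) j) p)
                       (alternating-cong pointwise p)))
    where
    lemma₁ : ∀ t a b → + 2 * t * a - + 2 * t * b ≡ + 2 * (t * (a - b))
    lemma₁ = solve-∀
    lemma₂ : ∀ k a b → (1ℤ + k) * a * b - a * (k * b) ≡ a * b
    lemma₂ = solve-∀
    pointwise : ∀ k → monomial (suc m) (suc j) k - monomial (suc m) j k ≡ monomial m j k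
    pointwise k rewrite ℕ.+-∸-assoc 1 j≤m = lemma₂ (+ k) ((+ suc k) ^ j) ((+ k) ^ (m ∸ j))

  -- For `f k = k ^ (m + 1)` the two ends are the scaled sums of `f` and of `f ∘ suc`, and `f 0` and
  -- `f p` both vanish modulo `p`.
  scaledSum-ends : ∀ m → scaledSum (suc m) 0 + scaledSum (suc m) (suc m) ≈ 0ℤ
  scaledSum-ends m = begin
    scaledSum (suc m) 0 + scaledSum (suc m) (suc m)
      ≡⟨ cong₂ (λ a b → (+ 2) ^ suc m * a + (+ 2) ^ suc m * b)
               (alternating-cong (λ k → ℤ.*-identityˡ (f k)) p)
               (alternating-cong (λ k → trans (cong (λ d → f (suc k) * (+ k) ^ d) (ℕ.n∸n≡0 m))
                                              (ℤ.*-identityʳ (f (suc k)))) p) ⟩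
    (+ 2) ^ suc m * alternating f p + (+ 2) ^ suc m * alternating (f ∘ suc) p
      ≡⟨ ℤ.*-distribˡ-+ ((+ 2) ^ suc m) (alternating f p) (alternating (f ∘ suc) p) ⟨
    (+ 2) ^ suc m * (alternating f p + alternating (f ∘ suc) p)
      ≈⟨ *-congˡ {(+ 2) ^ suc m} (≈-trans (alternating-shift-≈ f) (+-congˡ {0ℤ} (^-cong (suc m) p≈0))) ⟩
    (+ 2) ^ suc m * 0ℤ
      ≡⟨ ℤ.*-zeroʳ ((+ 2) ^ suc m) ⟩
    0ℤ ∎
    where
    f : ℕ → ℤ
    f k = (+ k) ^ suc m

  -- Induction on `m`: doubled, the terms of the recursion become increments of `scaledSum (suc m)`,
  -- and after telescoping the boundary values cancel by `scaledSum-ends`.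
  eulerianFrom-≈ : ∀ m i → i ℕ.≤ m → eulerianFrom -1ℤ m i ≈ scaledSum m i
  eulerianFrom-≈ zero .zero z≤n = ≈-sym (*-cancelˡ-2 (begin
    + 2 * scaledSum 0 0                                     ≡⟨ lemma (alternating (λ _ → 1ℤ) p) ⟩
    alternating (λ _ → 1ℤ) p + alternating (λ _ → 1ℤ) p     ≈⟨ alternating-shift-≈ (λ _ → 1ℤ) ⟩
    + 2 * 1ℤ                                                ∎))
    where
    lemma : ∀ a → + 2 * (1ℤ * a) ≡ a + a
    lemma = solve-∀
  eulerianFrom-≈ (suc m) i i≤1+m = *-cancelˡ-2 (begin
    + 2 * eulerianFrom -1ℤ (suc m) i
      ≡⟨ cong (_*_ (+ 2)) (sum-toℕ (suc m) (λ j → s j * eulerianFrom -1ℤ m j)) ⟩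
    + 2 * sumTo (λ j → s j * eulerianFrom -1ℤ m j) (suc m)
      ≡⟨ sumTo-*ˡ (+ 2) (λ j → s j * eulerianFrom -1ℤ m j) (suc m) ⟨
    sumTo (λ j → + 2 * (s j * eulerianFrom -1ℤ m j)) (suc m)
      ≈⟨ sumTo-≈ (suc m) step ⟩
    sumTo (signedTelescope D i) (suc m)
      ≡⟨ subst (λ k → sumTo (signedTelescope D i) k ≡ + 2 * D i - (D 0 + D k))
               (ℕ.m∸n+n≡m i≤1+m) (sumTo-signedTelescope D i (suc m ∸ i)) ⟩
    + 2 * D i - (D 0 + D (suc m))
      ≈⟨ +-congˡ {+ 2 * D i} (-‿cong (scaledSum-ends m)) ⟩
    + 2 * D i - 0ℤ
      ≡⟨ ℤ.+-identityʳ (+ 2 * D i) ⟩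
    + 2 * D i ∎)
    where
    s D : ℕ → ℤ
    s j = -1ℤ ^ ⟦ i < suc j ⟧
    D = scaledSum (suc m)

    lemma : ∀ s a → + 2 * (s * a) ≡ s * (+ 2 * a)
    lemma = solve-∀

    step : ∀ j → j ℕ.< suc m → + 2 * (s j * eulerianFrom -1ℤ m j) ≈ signedTelescope D i j
    step j (s≤s j≤m) = begin
      + 2 * (s j * eulerianFrom -1ℤ m j)  ≡⟨ lemma (s j) (eulerianFrom -1ℤ m j) ⟩
      s j * (+ 2 * eulerianFrom -1ℤ m j)  ≈⟨ *-congˡ {s j} (*-congˡ {+ 2} (eulerianFrom-≈ m j j≤m)) ⟩
      s j * (+ 2 * scaledSum m j)         ≡⟨ cong (s j *_) (scaledSum-step m j j≤m) ⟨
      s j * (D (suc j) - D j)             ∎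

  -- Fermat inverses and harmonic sums

  -- Fermat's inverse of k, since n = p - 2; junk value 0 at multiples of p.
  inverse : ℕ → ℤ
  inverse k = (+ k) ^ n

  oddInverse : ℕ → ℤ
  oddInverse k = if does (2 ∣? k) then 0ℤ else inverse k

  -- At `i = m = n` the monomial is `(k + 1) ^ n`, the inverse of `k + 1`, and doubling completes
  -- the scaling to `2 ^ (p - 1)`, which is 1 by Fermat.
  eulerian-≈ : + 2 * eulerian -1ℤ n ≈ alternating (inverse ∘ suc) (h ℕ.+ h)
  eulerian-≈ = begin
    + 2 * eulerian -1ℤ n
      ≡⟨ cong (_*_ (+ 2)) (eulerian-last -1ℤ n) ⟩
    + 2 * eulerianFrom -1ℤ n n
      ≈⟨ *-congˡ {+ 2} (eulerianFrom-≈ n n ℕ.≤-refl) ⟩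
    + 2 * ((+ 2) ^ n * alternating (monomial n n) p)
      ≡⟨ ℤ.*-assoc (+ 2) ((+ 2) ^ n) (alternating (monomial n n) p) ⟨
    (+ 2) ^ suc n * alternating (monomial n n) p
      ≈⟨ *-cong (fermat 2 2<p) (≡⇒≈ (alternating-cong pointwise p)) ⟩
    -- The sum over `k < p` has one more term, at `k = p - 1`, where `inverse p` vanishes.
    1ℤ * (alternating (inverse ∘ suc) (h ℕ.+ h) + -1ℤ ^ suc n * inverse p)
      ≈⟨ *-congˡ {1ℤ} (+-congˡ {S} (*-congˡ { -1ℤ ^ suc n} inverse-p)) ⟩
    1ℤ * (alternating (inverse ∘ suc) (h ℕ.+ h) + -1ℤ ^ suc n * 0ℤ)
      ≡⟨ lemma S (-1ℤ ^ suc n) ⟩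
    alternating (inverse ∘ suc) (h ℕ.+ h) ∎
    where
    S : ℤ
    S = alternating (inverse ∘ suc) (h ℕ.+ h)

    lemma : ∀ a b → 1ℤ * (a + b * 0ℤ) ≡ a
    lemma = solve-∀

    pointwise : ∀ k → monomial n n k ≡ inverse (suc k)
    pointwise k = trans (cong (λ d → inverse (suc k) * (+ k) ^ d) (ℕ.n∸n≡0 n)) (ℤ.*-identityʳ (inverse (suc k)))

    inverse-p : inverse p ≈ 0ℤ
    -- `n` must be exposed as a successor before `0ℤ ^ n` computes to 0.
    inverse-p = ≈-trans (^-cong n p≈0) (≡⇒≈ (cong (0ℤ ^_) (ℕ.+-suc h′ h′)))

  -- `b` is congruent to `- a`, and the exponent `n = p - 2` is odd.
  inverse-reflect : ∀ {a b} → a ℕ.+ b ≡ p → inverse b ≈ - inverse a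
  inverse-reflect {a} {b} a+b≡p = begin
    (+ b) ^ n            ≡⟨ cong (_^ n) (trans (lemma₁ (+ a) (+ b)) (cong (λ m → + m - + a) a+b≡p)) ⟩
    (+ p - + a) ^ n      ≈⟨ ^-cong n (≈-trans (+-congʳ { - + a} p≈0) (≡⇒≈ (ℤ.+-identityˡ (- + a)))) ⟩
    (- + a) ^ n          ≡⟨ neg-^ (+ a) n ⟩
    -1ℤ ^ n * inverse a  ≡⟨ cong (_* inverse a) (trans (lemma₂ (-1ℤ ^ n)) (cong (-_) (-1^[m+m]≡1 h))) ⟩
    -1ℤ * inverse a      ≡⟨ ℤ.-1*i≡-i (inverse a) ⟩
    - inverse a          ∎
    where
    lemma₁ : ∀ a b → b ≡ a + b - a
    lemma₁ = solve-∀
    lemma₂ : ∀ s → s ≡ - (- 1ℤ * s)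
    lemma₂ = solve-∀

  reflection : ∀ k → k ℕ.< h → suc k ℕ.+ ((h ∸ suc k) ℕ.+ h) ≡ h ℕ.+ h
  reflection k k<h = trans (sym (ℕ.+-assoc (suc k) (h ∸ suc k) h)) (cong (ℕ._+ h) (ℕ.m+[n∸m]≡n k<h))

  inverse-mirror : ∀ k → k ℕ.< h → inverse (suc ((h ∸ suc k) ℕ.+ h)) ≈ - inverse (suc k)
  inverse-mirror k k<h = inverse-reflect (trans (ℕ.+-suc (suc k) _) (cong suc (reflection k k<h)))

  sum-inverse : sumTo (inverse ∘ suc) (h ℕ.+ h) ≈ 0ℤ
  sum-inverse = begin
    sumTo (inverse ∘ suc) (h ℕ.+ h)  ≡⟨ sumTo-fold (inverse ∘ suc) h ⟩
    sumTo (λ k → inverse (suc k) + inverse (suc ((h ∸ suc k) ℕ.+ h))) h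
      ≈⟨ sumTo-≈ h (λ k k<h → ≈-trans (+-congˡ {inverse (suc k)} (inverse-mirror k k<h))
                                     (≡⇒≈ (ℤ.+-inverseʳ (inverse (suc k))))) ⟩
    sumTo (λ _ → 0ℤ) h               ≡⟨ trans (sumTo-const 0ℤ h) (ℤ.*-zeroʳ (+ h)) ⟩
    0ℤ                               ∎

  -- Reflection changes both the parity of the index and the sign of the inverse, so mirror terms
  -- agree and the lower half counts twice.
  alternating-inverse : alternating (inverse ∘ suc) (h ℕ.+ h) ≈ + 2 * alternating (inverse ∘ suc) h
  alternating-inverse = begin
    alternating (inverse ∘ suc) (h ℕ.+ h)
      ≡⟨ sumTo-fold (λ k → -1ℤ ^ k * inverse (suc k)) h ⟩
    sumTo (λ k → -1ℤ ^ k * inverse (suc k) + -1ℤ ^ ((h ∸ suc k) ℕ.+ h) * inverse (suc ((h ∸ suc k) ℕ.+ h))) h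
      ≈⟨ sumTo-≈ h step ⟩
    sumTo (λ k → + 2 * (-1ℤ ^ k * inverse (suc k))) h
      ≡⟨ sumTo-*ˡ (+ 2) (λ k → -1ℤ ^ k * inverse (suc k)) h ⟩
    + 2 * alternating (inverse ∘ suc) h ∎
    where
    lemma : ∀ s x → s * x + - 1ℤ * s * (- x) ≡ + 2 * (s * x)
    lemma = solve-∀

    step : ∀ k → k ℕ.< h →
      -1ℤ ^ k * inverse (suc k) + -1ℤ ^ ((h ∸ suc k) ℕ.+ h) * inverse (suc ((h ∸ suc k) ℕ.+ h)) ≈
      + 2 * (-1ℤ ^ k * inverse (suc k))
    step k k<h = ≈-trans
      (+-congˡ { -1ℤ ^ k * inverse (suc k)}
        (*-cong (≡⇒≈ (sym (-1^-parity {suc k} {m = h} (reflection k k<h)))) (inverse-mirror k k<h)))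
      (≡⇒≈ (lemma (-1ℤ ^ k) (inverse (suc k))))

  -- The even numbers up to `p - 1` are the `2 j` with `j` from 1 to `h`, and twice the inverse of
  -- `2 j` is the inverse of `j` because `2 ^ suc n` is 1 by Fermat.
  sum-inverse-doubles : + 2 * sumTo (λ i → inverse (suc (suc (i ℕ.+ i)))) h ≈ sumTo (inverse ∘ suc) h
  sum-inverse-doubles = begin
    + 2 * sumTo (λ i → inverse (suc (suc (i ℕ.+ i)))) h
      ≡⟨ cong (_*_ (+ 2)) (trans (sumTo-cong double h) (sumTo-*ˡ ((+ 2) ^ n) (inverse ∘ suc) h)) ⟩
    + 2 * ((+ 2) ^ n * sumTo (inverse ∘ suc) h)
      ≡⟨ ℤ.*-assoc (+ 2) ((+ 2) ^ n) (sumTo (inverse ∘ suc) h) ⟨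
    (+ 2) ^ suc n * sumTo (inverse ∘ suc) h
      ≈⟨ *-congʳ {sumTo (inverse ∘ suc) h} (fermat 2 2<p) ⟩
    1ℤ * sumTo (inverse ∘ suc) h
      ≡⟨ ℤ.*-identityˡ (sumTo (inverse ∘ suc) h) ⟩
    sumTo (inverse ∘ suc) h ∎
    where
    lemma : ∀ x → 1ℤ + (1ℤ + (x + x)) ≡ + 2 * (1ℤ + x)
    lemma = solve-∀
    double : ∀ i → inverse (suc (suc (i ℕ.+ i))) ≡ (+ 2) ^ n * inverse (suc i)
    double i = trans (cong (_^ n) (lemma (+ i))) (^-distribʳ-* (+ 2) (+ suc i) n)

  -- `1 + (-1)^k` is twice the indicator that `k + 1` is odd.
  sum-oddInverse : + 2 * sumTo (oddInverse ∘ suc) h ≡ sumTo (inverse ∘ suc) h + alternating (inverse ∘ suc) h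
  sum-oddInverse = trans (sym (sumTo-*ˡ (+ 2) (oddInverse ∘ suc) h)) (trans
    (sumTo-cong pointwise h)
    (sumTo-+ (inverse ∘ suc) (λ k → -1ℤ ^ k * inverse (suc k)) h))
    where
    split : ∀ b x → + 2 * (if b then 0ℤ else x) ≡ (+ 2 - + 2 * χ b) * x
    split true  x = refl
    split false x = refl
    lemma : ∀ s x → (+ 2 - (1ℤ + - 1ℤ * s)) * x ≡ x + s * x
    lemma = solve-∀
    pointwise : ∀ k → + 2 * oddInverse (suc k) ≡ inverse (suc k) + -1ℤ ^ k * inverse (suc k)
    pointwise k = trans (split (does (2 ∣? suc k)) (inverse (suc k))) (trans
      (cong (λ e → (+ 2 - e) * inverse (suc k))
            (trans (even-indicator (suc k)) (cong (_+ -1ℤ ^ suc k) (ℤ.^-zeroˡ (suc k)))))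
      (lemma (-1ℤ ^ k) (inverse (suc k))))

  -- As `p - 1` is -1 modulo `p`, removing this factor from `(p - 1) !` in Wilson's theorem turns -1
  -- into 1.
  n!≈1 : + (n !) ≈ 1ℤ
  n!≈1 = begin
    + (n !)                            ≡⟨ lemma (+ n) (+ (n !)) ⟩
    + p * + (n !) - + suc n * + (n !)  ≡⟨ cong (λ m → + p * + (n !) - m) (ℤ.pos-* (suc n) (n !)) ⟨
    + p * + (n !) - + (suc n !)        ≈⟨ +-cong (*-congʳ {+ (n !)} p≈0) (-‿cong wilson) ⟩
    1ℤ                                 ∎
    where
    lemma : ∀ m a → a ≡ (1ℤ + (1ℤ + m)) * a - (1ℤ + m) * a
    lemma = solve-∀

  oddInverse-N : + 2 * sumTo (oddInverse ∘ suc) h ≈ 1ℤ - + 2 * + N n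
  oddInverse-N = *-cancelˡ-2 (begin
    + 2 * (+ 2 * sumTo (oddInverse ∘ suc) h)    ≡⟨ cong (_*_ (+ 2)) sum-oddInverse ⟩
    + 2 * (H + A)                               ≡⟨ ℤ.*-distribˡ-+ (+ 2) H A ⟩
    + 2 * H + + 2 * A                           ≈⟨ +-cong (*-congˡ {+ 2} H≈-A₂) (≈-sym alternating-inverse) ⟩
    + 2 * (0ℤ - A₂) + A₂                        ≡⟨ lemma₁ A₂ ⟩
    - A₂                                        ≈⟨ -‿cong eulerian-≈ ⟨
    - (+ 2 * E)                                 ≡⟨ lemma₂ E ⟩
    + 2 * (1ℤ - (1ℤ + E))                       ≈⟨ *-congˡ {+ 2} (+-congˡ {1ℤ} (-‿cong (+-congʳ {E} n!≈1))) ⟨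
    + 2 * (1ℤ - (+ (n !) + E))                  ≡⟨ cong (λ m → + 2 * (1ℤ - (m + E))) (eulerian-1 n) ⟨
    + 2 * (1ℤ - (eulerian 1ℤ n + E))            ≡⟨ cong (λ m → + 2 * (1ℤ - m)) (2N≡eulerian n) ⟨
    + 2 * (1ℤ - + 2 * + N n)                    ∎)
    where
    -- `A₂` is the alternating sum up to `p - 1`, `A` the one up to `h`, and `E` the Eulerian value
    -- at -1, not the even part of the harmonic sum.
    H A A₂ E : ℤ
    H  = sumTo (inverse ∘ suc) h
    A  = alternating (inverse ∘ suc) h
    A₂ = alternating (inverse ∘ suc) (h ℕ.+ h)
    E  = eulerian -1ℤ n

    lemma₁ : ∀ a → + 2 * (0ℤ - a) + a ≡ - a
    lemma₁ = solve-∀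
    lemma₂ : ∀ a → - (+ 2 * a) ≡ + 2 * (1ℤ - (1ℤ + a))
    lemma₂ = solve-∀
    lemma₃ : ∀ a b → b ≡ a + b - a
    lemma₃ = solve-∀

    H≈-A₂ : H ≈ 0ℤ - A₂
    H≈-A₂ = begin
      H                          ≈⟨ sum-inverse-doubles ⟨
      D                          ≡⟨ lemma₃ A₂ D ⟩
      -- `A₂` and the doubled even terms `D` add up to the sum of all inverses, which vanishes
      -- modulo `p`.
      A₂ + D - A₂                ≡⟨ cong (_- A₂) (alternating-double (inverse ∘ suc) h) ⟩
      sumTo (inverse ∘ suc) (h ℕ.+ h) - A₂
                                 ≈⟨ +-congʳ { - A₂} sum-inverse ⟩
      0ℤ - A₂                    ∎
      where
      D : ℤ
      D = + 2 * sumTo (λ i → inverse (suc (suc (i ℕ.+ i)))) h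

  -- Every denominator up to `m < p` is a unit modulo `p`, and by Fermat `inverse k` is the residue
  -- of `1 / k`.
  oddHarmonic-↦ : ∀ m → m ℕ.< p → oddHarmonic m ↦ sumTo (oddInverse ∘ suc) m
  oddHarmonic-↦ zero    _   = 0ℚ↦0
  oddHarmonic-↦ (suc k) k<p with does (2 ∣? suc k) | oddHarmonic-↦ k (ℕ.<-trans (ℕ.n<1+n k) k<p)
  ... | true  | ih = +-↦ ih 0ℚ↦0
  ... | false | ih = +-↦ ih (/-↦ 1ℤ (suc k) (p∤ k<p)
    (≈-sym (≈-trans (≡⇒≈ (ℤ.*-comm (inverse (suc k)) (+ suc k))) (fermat (suc k) k<p))))

  -- Both sides have the residue `sumTo (oddInverse ∘ suc) h`; on the right this is `oddInverse-N`
  -- with the denominator 2 cleared.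
  oddHarmonic-N : oddHarmonic h ≡ ((+ 1 - + 2 * + N n) ℚ./ 2) [modℚ p ]
  oddHarmonic-N = ↦-≡modℚ (oddHarmonic-↦ h (s≤s (ℕ.m≤m+n h h)))
    (/-↦ (1ℤ - + 2 * + N n) 2 (p∤ 2<p)
      (≈-trans (≈-sym oddInverse-N) (≡⇒≈ (ℤ.*-comm (+ 2) (sumTo (oddInverse ∘ suc) h)))))

-- Writing an odd prime as `2 h + 1`

halve : ∀ n → (∃[ m ] n ≡ m ℕ.+ m) ⊎ (∃[ m ] n ≡ suc (m ℕ.+ m))
halve zero    = inj₁ (0 , refl)
halve (suc n) with halve n
... | inj₁ (m , eq) = inj₂ (m , cong suc eq)
... | inj₂ (m , eq) = inj₁ (suc m , cong suc (trans eq (sym (ℕ.+-suc m m))))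

m+m≡m*2 : ∀ m → m ℕ.+ m ≡ m ℕ.* 2
m+m≡m*2 m = trans (cong (m ℕ.+_) (sym (ℕ.+-identityʳ m))) (ℕ.*-comm 2 m)

-- An even prime is 2, and 1 is not prime, so half of `p - 1` is a successor.
oddPrime : ∀ {p} → Prime p → p ≢ 2 → ∃[ h′ ] p ≡ suc (suc h′ ℕ.+ suc h′)
oddPrime {p} pr p≢2 with halve p
... | inj₁ (m , p≡m+m) =
  [ (λ ()) , (λ 2≡p → contradiction (sym 2≡p) p≢2) ]′ (prime⇒irreducible pr (ℕ∣.divides m (trans p≡m+m (m+m≡m*2 m))))
... | inj₂ (zero , p≡1)  = contradiction (subst Prime p≡1 pr) ¬prime[1]
... | inj₂ (suc h′ , eq) = h′ , eq

half-double : ∀ m → (m ℕ.+ m) / 2 ≡ m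
half-double m = trans (cong (_/ 2) (m+m≡m*2 m)) (m*n/n≡m m 2)

theorem4 : (p : ℕ) → Prime p → p ≢ 2 →
    oddHarmonic ((p ∸ 1) / 2) ≡ ((+ 1 ℤ.- + 2 ℤ.* + N (p ∸ 2)) ℚ./ 2) [modℚ p ]
theorem4 p pr p≢2 with oddPrime pr p≢2
-- `p ∸ 1` and `p ∸ 2` now compute, but the quotient by 2 has to be rewritten.
... | h′ , refl = subst (λ m → oddHarmonic m ≡ (+ 1 - + 2 * + N (h′ ℕ.+ suc h′)) ℚ./ 2 [modℚ p ])
                        (sym (half-double (suc h′))) (OddPrime.oddHarmonic-N pr)
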